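{- Let $P$ be a process, $\Gamma$ a typing environment and $w$ a natural number. If $\Gamma\vdash P:w$, then $P$ terminates, i.e. there is no infinite sequence of processes $(P_i)_{i\ge 0}$ with $P_0=P$ and $P_i\longrightarrow P_{i+1}$ for all $i$.
   Context: **Processes.** Fix an infinite set of names $a,b,c,\dots,x,y,\dots$. Values: $v ::= \star \mid a$ ($\star$ a constant, $a$ a name). Processes (asynchronous $\pi$-calculus): $P ::= \mathbf 0 \mid P_1|P_2 \mid \overline a\langle v\rangle \mid (\nu a)P \mid a(x).P \mid\, !a(x).P$. Restriction $(\nu a)P$ binds $a$ in $P$; $a(x).P$ and $!a(x).P$ bind $x$ in $P$. $\mathrm{fn}(P)$ is the set of free names; $P[v/x]$ is capture-avoiding substitution. Processes are implicitly assumed written so that all bound names are pairwise distinct and different from the free names, with implicit $\alpha$-renaming whenever needed. **Types.** $T ::= \sharp^{k}T \mid \mathsf i^{k}T \mid \mathsf o^{k}T \mid \mathbb U$, with $k\in\mathbb N$ (the level). Subtyping $\le$ is the least reflexive and transitive relation such that: $\sharp^kT\le \mathsf i^kT$; $\sharp^kT\le\mathsf o^kT$; if $T\le S$ and $k_1\le k_2$ then $\mathsf i^{k_2}T\le\mathsf i^{k_1}S$; if $T\le S$ and $k_1\le k_2$ then $\mathsf o^{k_1}S\le\mathsf o^{k_2}T$. **Typing.** A typing environment $\Gamma$ is a partial map from names to types; $\Gamma,a:T$ is its extension, defined only when $a\notin\mathrm{dom}(\Gamma)$. Values: $\Gamma\vdash\star:\mathbb U$; $\Gamma\vdash a:T$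 if $\Gamma(a)=T$; if $\Gamma\vdash a:T$ and $T\le U$ then $\Gamma\vdash a:U$. Processes ($\Gamma\vdash P:w$, $w\in\mathbb N$ the weight): - $\Gamma\vdash\mathbf 0:0$; - if $\Gamma\vdash a:\mathsf o^kT$ and $\Gamma\vdash v:T$ then $\Gamma\vdash\overline a\langle v\rangle:k$; - if $\Gamma\vdash a:\mathsf i^kT$ and $\Gamma,x:T\vdash P:w$ then $\Gamma\vdash a(x).P:w$; - if $\Gamma\vdash a:\mathsf i^kT$, $\Gamma,x:T\vdash P:w$ and $k>w$ then $\Gamma\vdash\,!a(x).P:0$; - if $\Gamma,a:T\vdash P:w$ then $\Gamma\vdash(\nu a)P:w$; - if $\Gamma\vdash P_1:w_1$ and $\Gamma\vdash P_2:w_2$ then $\Gamma\vdash P_1|P_2:\max(w_1,w_2)$. **Structural congruence** $\equiv$ is the smallest equivalence relation that is a congruence, contains $\alpha$-conversion and satisfies: $P|(Q|R)\equiv(P|Q)|R$, $P|Q\equiv Q|P$, $P|\mathbf 0\equiv P$, $(\nu a)\mathbf 0\equiv\mathbf 0$, $(\nu a)(\nu b)P\equiv(\nu b)(\nu a)P$, and $(\nu a)(P|Q)\equiv P|(\nu a)Q$ if $a\notin\mathrm{fn}(P)$. **Reduction** $\longrightarrow$ is given by: $a(x).P\,|\,\overline a\langle v\rangle\longrightarrow P[v/x]$; $!a(x).P\,|\,\overline a\langle v\rangle\longrightarrow\,!a(x).P\,|\,P[v/x]$; closure under $\cdot|Q$ and under $(\nu a)\cdot$; and if $Q\equiv P\longrightarrow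 P'\equiv Q'$ then $Q\longrightarrow Q'$. -}

module Defs where

open import Data.Nat using (ℕ; zero; suc; _≤_; _>_; _⊔_)
open import Data.Maybe using (Maybe; just; nothing; map; zipWith)
open import Data.Product using (∃; _×_)
open import Relation.Nullary using (¬_)
open import Relation.Binary.PropositionalEquality using (_≡_)

-- Names are de Bruijn indices, so that processes are identified up to
-- α-conversion: under n binders, the indices 0 … n-1 denote the bound names
-- (0 being the innermost) and n + i denotes the free name i.
Name : Set
Name = ℕ

data Value : Set where
  ⋆    : Value
  name : Name → Value

infixr 6 _∣_

data Process : Set where
  𝟎     : Process
  _∣_   : Process → Process → Process
  send  : Name → Value → Process      -- a̅⟨v⟩
  ν     : Process → Process           -- (νa)P, binds index 0
  recv  : Name → Process → Process    -- a(x).P, binds index 0 in P only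
  !recv : Name → Process → Process    -- !a(x).P, binds index 0 in P only

ext : (Name → Name) → Name → Name
ext ρ zero    = zero
ext ρ (suc a) = suc (ρ a)

renameV : (Name → Name) → Value → Value
renameV ρ ⋆        = ⋆
renameV ρ (name a) = name (ρ a)

rename : (Name → Name) → Process → Process
rename ρ 𝟎           = 𝟎
rename ρ (P ∣ Q)     = rename ρ P ∣ rename ρ Q
rename ρ (send a v)  = send (ρ a) (renameV ρ v)
rename ρ (ν P)       = ν (rename (ext ρ) P)
rename ρ (recv a P)  = recv (ρ a) (rename (ext ρ) P)
rename ρ (!recv a P) = !recv (ρ a) (rename (ext ρ) P)

weaken : Process → Process
weaken = rename suc

swap : Name → Name
swap zero          = suc zero
swap (suc zero)    = zero
swap (suc (suc a)) = suc (suc a)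

-- Only names may be the subject of a prefix, so substituting ⋆ for a name that
-- occurs in subject position yields no process: substitution is partial.
asName : Value → Maybe Name
asName ⋆        = nothing
asName (name a) = just a

exts : (Name → Value) → Name → Value
exts σ zero    = name zero
exts σ (suc a) = renameV suc (σ a)

substV : (Name → Value) → Value → Value
substV σ ⋆        = ⋆
substV σ (name a) = σ a

subst : (Name → Value) → Process → Maybe Process
subst σ 𝟎           = just 𝟎
subst σ (P ∣ Q)     = zipWith _∣_ (subst σ P) (subst σ Q)
subst σ (send a v)  = map (λ b → send b (substV σ v)) (asName (σ a))
subst σ (ν P)       = map ν (subst (exts σ) P)
subst σ (recv a P)  = zipWith recv (asName (σ a)) (subst (exts σ) P)
subst σ (!recv a P) = zipWith !recv (asName (σ a)) (subst (exts σ) P)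

single : Value → Name → Value
single v zero    = v
single v (suc a) = name a

-- P[v/x], where x is index 0 of P and the binder of x is removed.
infix 8 _[_]

_[_] : Process → Value → Maybe Process
P [ v ] = subst (single v) P

infix 4 _≡ₛ_

data _≡ₛ_ : Process → Process → Set where
  ≡ₛ-refl  : ∀ {P} → P ≡ₛ P
  ≡ₛ-sym   : ∀ {P Q} → P ≡ₛ Q → Q ≡ₛ P
  ≡ₛ-trans : ∀ {P Q R} → P ≡ₛ Q → Q ≡ₛ R → P ≡ₛ R

  ∣-cong     : ∀ {P P′ Q Q′} → P ≡ₛ P′ → Q ≡ₛ Q′ → P ∣ Q ≡ₛ P′ ∣ Q′
  ν-cong     : ∀ {P P′} → P ≡ₛ P′ → ν P ≡ₛ ν P′
  recv-cong  : ∀ {a P P′} → P ≡ₛ P′ → recv a P ≡ₛ recv a P′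
  !recv-cong : ∀ {a P P′} → P ≡ₛ P′ → !recv a P ≡ₛ !recv a P′

  ∣-assoc     : ∀ {P Q R} → P ∣ (Q ∣ R) ≡ₛ (P ∣ Q) ∣ R
  ∣-comm      : ∀ {P Q} → P ∣ Q ≡ₛ Q ∣ P
  ∣-identityʳ : ∀ {P} → P ∣ 𝟎 ≡ₛ P
  ν-𝟎         : ν 𝟎 ≡ₛ 𝟎
  ν-comm      : ∀ {P} → ν (ν P) ≡ₛ ν (ν (rename swap P))
  -- The processes in which index 0 is not free are exactly the weakenings.
  ν-extrude   : ∀ {P Q} → ν (weaken P ∣ Q) ≡ₛ P ∣ ν Q

infix 4 _⟶_

data _⟶_ : Process → Process → Set where
  comm   : ∀ {a P v P′} → P [ v ] ≡ just P′ →
           recv a P ∣ send a v ⟶ P′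
  !comm  : ∀ {a P v P′} → P [ v ] ≡ just P′ →
           !recv a P ∣ send a v ⟶ !recv a P ∣ P′
  par    : ∀ {P P′ Q} → P ⟶ P′ → P ∣ Q ⟶ P′ ∣ Q
  res    : ∀ {P P′} → P ⟶ P′ → ν P ⟶ ν P′
  struct : ∀ {P P′ Q Q′} → Q ≡ₛ P → P ⟶ P′ → P′ ≡ₛ Q′ → Q ⟶ Q′

data Type : Set where
  ♯ : ℕ → Type → Type
  𝕚 : ℕ → Type → Type
  𝕠 : ℕ → Type → Type
  𝕌 : Type

infix 4 _≤ₜ_

data _≤ₜ_ : Type → Type → Set where
  ≤ₜ-refl  : ∀ {T} → T ≤ₜ T
  ≤ₜ-trans : ∀ {T S U} → T ≤ₜ S → S ≤ₜ U → T ≤ₜ U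
  ♯≤𝕚      : ∀ {k T} → ♯ k T ≤ₜ 𝕚 k T
  ♯≤𝕠      : ∀ {k T} → ♯ k T ≤ₜ 𝕠 k T
  𝕚-mono   : ∀ {k₁ k₂ T S} → T ≤ₜ S → k₁ ≤ k₂ → 𝕚 k₂ T ≤ₜ 𝕚 k₁ S
  𝕠-anti   : ∀ {k₁ k₂ T S} → T ≤ₜ S → k₁ ≤ k₂ → 𝕠 k₁ S ≤ₜ 𝕠 k₂ T

Env : Set
Env = Name → Maybe Type

-- Extension with the (necessarily fresh) index 0.
infixl 5 _▸_

_▸_ : Env → Type → Env
(Γ ▸ T) zero    = just T
(Γ ▸ T) (suc a) = Γ a

infix 4 _⊢ᵥ_∶_ _⊢_∶_

data _⊢ᵥ_∶_ (Γ : Env) : Value → Type → Set where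
  ⊢⋆    : Γ ⊢ᵥ ⋆ ∶ 𝕌
  ⊢name : ∀ {a T} → Γ a ≡ just T → Γ ⊢ᵥ name a ∶ T
  ⊢sub  : ∀ {a T U} → Γ ⊢ᵥ name a ∶ T → T ≤ₜ U → Γ ⊢ᵥ name a ∶ U

data _⊢_∶_ (Γ : Env) : Process → ℕ → Set where
  ⊢𝟎     : Γ ⊢ 𝟎 ∶ 0
  ⊢send  : ∀ {a v k T} → Γ ⊢ᵥ name a ∶ 𝕠 k T → Γ ⊢ᵥ v ∶ T → Γ ⊢ send a v ∶ k
  ⊢recv  : ∀ {a P k T w} → Γ ⊢ᵥ name a ∶ 𝕚 k T → Γ ▸ T ⊢ P ∶ w →
           Γ ⊢ recv a P ∶ w
  ⊢!recv : ∀ {a P k T w} → Γ ⊢ᵥ name a ∶ 𝕚 k T → Γ ▸ T ⊢ P ∶ w → k > w →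
           Γ ⊢ !recv a P ∶ 0
  ⊢ν     : ∀ {P T w} → Γ ▸ T ⊢ P ∶ w → Γ ⊢ ν P ∶ w
  ⊢∣     : ∀ {P₁ P₂ w₁ w₂} → Γ ⊢ P₁ ∶ w₁ → Γ ⊢ P₂ ∶ w₂ →
           Γ ⊢ P₁ ∣ P₂ ∶ w₁ ⊔ w₂

Terminates : Process → Set
Terminates P =
  ¬ ∃ λ (s : ℕ → Process) → s 0 ≡ P × (∀ i → s i ⟶ s (suc i))

{-# OPTIONS --safe #-}
-- Replace the maximum in the weight of a parallel composition by a sum, and let an
-- output at level k cost b ^ k. Substitution does not change the number of outputs
-- of a process, so if b exceeds the number of outputs of the initial process, the
-- body of an input replicated at level k always costs less than the output at level
-- at least k that triggers it. Structural congruence preserves the total cost, and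
-- every reduction decreases it.
module Submission where

open import Data.Nat using (ℕ; zero; suc; _+_; _*_; _^_; _⊔_; _≤_; _<_; z≤n; s≤s)
open import Data.Nat.Properties
open import Data.Nat.Induction using (<-wellFounded)
open import Data.Maybe using (just)
open import Data.Maybe.Properties using (just-injective)
open import Data.Product using (_×_; _,_; ∃; proj₁; proj₂)
open import Data.Empty using (⊥)
open import Function using (_∘_; _⇔_; mk⇔; Equivalence)
import Function.Properties.Equivalence as ⇔
open import Induction.WellFounded using (Acc; acc)
open import Relation.Nullary using (¬_)
open import Relation.Binary.PropositionalEquality
  using (_≡_; refl; sym; trans; _≗_)
open import Defs

open Equivalence using (to; from)

𝕌-minimal : ∀ {T U} → T ≤ₜ U → T ≡ 𝕌 → U ≡ 𝕌
𝕌-minimal ≤ₜ-refl        eq = eq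
𝕌-minimal (≤ₜ-trans p q) eq = 𝕌-minimal q (𝕌-minimal p eq)

-- `U ≤ₜ 𝕚 k T` computed by recursion on `U`, since `≤ₜ-trans` blocks a direct inversion of
-- subtyping. `Outputs` does the same for `𝕠 k T`.
Inputs : Type → ℕ → Type → Set
Inputs (♯ l S) k T = S ≤ₜ T × k ≤ l
Inputs (𝕚 l S) k T = S ≤ₜ T × k ≤ l
Inputs (𝕠 l S) k T = ⊥
Inputs 𝕌       k T = ⊥

Outputs : Type → ℕ → Type → Set
Outputs (♯ l S) k T = T ≤ₜ S × l ≤ k
Outputs (𝕚 l S) k T = ⊥
Outputs (𝕠 l S) k T = T ≤ₜ S × l ≤ k
Outputs 𝕌       k T = ⊥

-- With an arbitrary supertype `V`, transitivity becomes composition; the inversion itself is the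
-- instance `V = 𝕚 k T`.
Inputs-≤ₜ : ∀ {U V k T} → U ≤ₜ V → Inputs V k T → Inputs U k T
Inputs-≤ₜ ≤ₜ-refl        h         = h
Inputs-≤ₜ (≤ₜ-trans p q) h         = Inputs-≤ₜ p (Inputs-≤ₜ q h)
Inputs-≤ₜ ♯≤𝕚            h         = h
Inputs-≤ₜ (𝕚-mono p q)   (r , k≤l) = ≤ₜ-trans p r , ≤-trans k≤l q

Outputs-≤ₜ : ∀ {U V k T} → U ≤ₜ V → Outputs V k T → Outputs U k T
Outputs-≤ₜ ≤ₜ-refl        h         = h
Outputs-≤ₜ (≤ₜ-trans p q) h         = Outputs-≤ₜ p (Outputs-≤ₜ q h)
Outputs-≤ₜ ♯≤𝕠            h         = h
Outputs-≤ₜ (𝕠-anti p q)   (r , l≤k) = ≤ₜ-trans r p , ≤-trans q l≤k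

-- Only `♯` has both capabilities, and its own argument and level then lie between the two sides.
Inputs-Outputs : ∀ U {k T l S} → Inputs U k T → Outputs U l S → S ≤ₜ T × k ≤ l
Inputs-Outputs (♯ _ _) (p , q) (r , s) = ≤ₜ-trans r p , ≤-trans q s

⊢name⁻¹ : ∀ {Γ a T} → Γ ⊢ᵥ name a ∶ T → ∃ λ S → Γ a ≡ just S × S ≤ₜ T
⊢name⁻¹ (⊢name eq) = _ , eq , ≤ₜ-refl
⊢name⁻¹ (⊢sub d p) with ⊢name⁻¹ d
... | S , eq , q = S , eq , ≤ₜ-trans q p

-- `⊢sub` covers names only; the case of `⋆` rests on `𝕌` having no other supertype.
⊢ᵥ-≤ₜ : ∀ {Γ v T U} → Γ ⊢ᵥ v ∶ T → T ≤ₜ U → Γ ⊢ᵥ v ∶ U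
⊢ᵥ-≤ₜ {v = ⋆}      ⊢⋆ p rewrite 𝕌-minimal p refl = ⊢⋆
⊢ᵥ-≤ₜ {v = name _} d  p = ⊢sub d p

-- Both judgements descend from the single entry `Γ a`. The first component makes the transmitted
-- value fit the parameter; the second makes a replicated input lose cost.
channel-agreement : ∀ {Γ a k T l S} → Γ ⊢ᵥ name a ∶ 𝕚 k T → Γ ⊢ᵥ name a ∶ 𝕠 l S →
                    S ≤ₜ T × k ≤ l
channel-agreement i o with ⊢name⁻¹ i | ⊢name⁻¹ o
... | U , eq , p | V , eq′ , q with just-injective (trans (sym eq) eq′)
...   | refl = Inputs-Outputs U (Inputs-≤ₜ p (≤ₜ-refl , ≤-refl))
                                (Outputs-≤ₜ q (≤ₜ-refl , ≤-refl))

-- `Δ` is unconstrained outside the image of `ρ`, so the two directions give weakening and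
-- strengthening at once.
⊢ᵥ-rename : ∀ {Γ Δ ρ} → Γ ≗ Δ ∘ ρ → ∀ v {T} → Γ ⊢ᵥ v ∶ T ⇔ Δ ⊢ᵥ renameV ρ v ∶ T
⊢ᵥ-rename Γ≗Δρ ⋆        = mk⇔ (λ { ⊢⋆ → ⊢⋆ }) (λ { ⊢⋆ → ⊢⋆ })
⊢ᵥ-rename Γ≗Δρ (name a) = mk⇔
  (λ d → let _ , eq , p = ⊢name⁻¹ d in ⊢sub (⊢name (trans (sym (Γ≗Δρ a)) eq)) p)
  (λ d → let _ , eq , p = ⊢name⁻¹ d in ⊢sub (⊢name (trans (Γ≗Δρ a) eq)) p)

▸-ext : ∀ {Γ Δ : Env} {ρ T} → Γ ≗ Δ ∘ ρ → Γ ▸ T ≗ (Δ ▸ T) ∘ ext ρ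
▸-ext Γ≗Δρ zero    = refl
▸-ext Γ≗Δρ (suc a) = Γ≗Δρ a

▸-swap : ∀ {Γ : Env} {S T} → Γ ▸ S ▸ T ≗ (Γ ▸ T ▸ S) ∘ swap
▸-swap zero          = refl
▸-swap (suc zero)    = refl
▸-swap (suc (suc a)) = refl

infix 4 _⊢ˢ_∶_

_⊢ˢ_∶_ : Env → (Name → Value) → Env → Set
Δ ⊢ˢ σ ∶ Γ = ∀ a {T} → Γ a ≡ just T → Δ ⊢ᵥ σ a ∶ T

⊢ˢ-exts : ∀ {Γ Δ σ T} → Δ ⊢ˢ σ ∶ Γ → Δ ▸ T ⊢ˢ exts σ ∶ Γ ▸ T
⊢ˢ-exts         ⊢σ zero    eq = ⊢name eq
⊢ˢ-exts {σ = σ} ⊢σ (suc a) eq = to (⊢ᵥ-rename (λ _ → refl) (σ a)) (⊢σ a eq)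

⊢ˢ-single : ∀ {Γ v T} → Γ ⊢ᵥ v ∶ T → Γ ⊢ˢ single v ∶ Γ ▸ T
⊢ˢ-single ⊢v zero    refl = ⊢v
⊢ˢ-single ⊢v (suc a) eq   = ⊢name eq

⊢ᵥ-subst : ∀ {Γ Δ σ} → Δ ⊢ˢ σ ∶ Γ → ∀ {v T} → Γ ⊢ᵥ v ∶ T → Δ ⊢ᵥ substV σ v ∶ T
⊢ᵥ-subst ⊢σ ⊢⋆         = ⊢⋆
⊢ᵥ-subst ⊢σ (⊢name eq) = ⊢σ _ eq
⊢ᵥ-subst ⊢σ (⊢sub d p) = ⊢ᵥ-≤ₜ (⊢ᵥ-subst ⊢σ d) p

module Costed (cost : ℕ → ℕ)
              (cost-pos : ∀ k → 0 < cost k)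
              (cost-mono : ∀ {k l} → k ≤ l → cost k ≤ cost l) where

  infix 4 _⊩_∶_

  -- The side condition of `⊩!recv` compares costs rather than levels, so it directly states the
  -- loss incurred when an output is traded for the body.
  data _⊩_∶_ (Γ : Env) : Process → ℕ → Set where
    ⊩𝟎     : Γ ⊩ 𝟎 ∶ 0
    ⊩send  : ∀ {a v k T} → Γ ⊢ᵥ name a ∶ 𝕠 k T → Γ ⊢ᵥ v ∶ T →
             Γ ⊩ send a v ∶ cost k
    ⊩recv  : ∀ {a P k T m} → Γ ⊢ᵥ name a ∶ 𝕚 k T → Γ ▸ T ⊩ P ∶ m →
             Γ ⊩ recv a P ∶ m
    ⊩!recv : ∀ {a P k T m} → Γ ⊢ᵥ name a ∶ 𝕚 k T → Γ ▸ T ⊩ P ∶ m → m < cost k →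
             Γ ⊩ !recv a P ∶ 0
    ⊩ν     : ∀ {P T m} → Γ ▸ T ⊩ P ∶ m → Γ ⊩ ν P ∶ m
    ⊩∣     : ∀ {P Q m n} → Γ ⊩ P ∶ m → Γ ⊩ Q ∶ n → Γ ⊩ P ∣ Q ∶ m + n

  ⊩-resp-≡ : ∀ {Γ P m n} → m ≡ n → Γ ⊩ P ∶ m → Γ ⊩ P ∶ n
  ⊩-resp-≡ refl d = d

  ⊩-rename⁺ : ∀ {Γ Δ ρ P m} → Γ ≗ Δ ∘ ρ → Γ ⊩ P ∶ m → Δ ⊩ rename ρ P ∶ m
  ⊩-rename⁺ e ⊩𝟎              = ⊩𝟎
  ⊩-rename⁺ e (⊩send {v = v} a d) =
    ⊩send (to (⊢ᵥ-rename e (name _)) a) (to (⊢ᵥ-rename e v) d)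
  ⊩-rename⁺ e (⊩recv a d)     =
    ⊩recv (to (⊢ᵥ-rename e (name _)) a) (⊩-rename⁺ (▸-ext e) d)
  ⊩-rename⁺ e (⊩!recv a d lt) =
    ⊩!recv (to (⊢ᵥ-rename e (name _)) a) (⊩-rename⁺ (▸-ext e) d) lt
  ⊩-rename⁺ e (⊩ν d)          = ⊩ν (⊩-rename⁺ (▸-ext e) d)
  ⊩-rename⁺ e (⊩∣ c d)        = ⊩∣ (⊩-rename⁺ e c) (⊩-rename⁺ e d)

  -- Needed to read `ν-comm` and `ν-extrude` backwards. The recursion is on `P` because the shape of
  -- `rename ρ P` is known only once that of `P` is.
  ⊩-rename⁻ : ∀ {Γ Δ ρ} → Γ ≗ Δ ∘ ρ → ∀ P {m} → Δ ⊩ rename ρ P ∶ m → Γ ⊩ P ∶ m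
  ⊩-rename⁻ e 𝟎           ⊩𝟎              = ⊩𝟎
  ⊩-rename⁻ e (P ∣ Q)     (⊩∣ c d)        = ⊩∣ (⊩-rename⁻ e P c) (⊩-rename⁻ e Q d)
  ⊩-rename⁻ e (send b v)  (⊩send a d)     =
    ⊩send (from (⊢ᵥ-rename e (name b)) a) (from (⊢ᵥ-rename e v) d)
  ⊩-rename⁻ e (ν P)       (⊩ν d)          = ⊩ν (⊩-rename⁻ (▸-ext e) P d)
  ⊩-rename⁻ e (recv b P)  (⊩recv a d)     =
    ⊩recv (from (⊢ᵥ-rename e (name b)) a) (⊩-rename⁻ (▸-ext e) P d)
  ⊩-rename⁻ e (!recv b P) (⊩!recv a d lt) =
    ⊩!recv (from (⊢ᵥ-rename e (name b)) a) (⊩-rename⁻ (▸-ext e) P d) lt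

  -- The cost of an output comes from the level in its typing derivation, which substitution keeps,
  -- so `m` is unchanged.
  ⊩-subst : ∀ {Γ Δ σ} → Δ ⊢ˢ σ ∶ Γ → ∀ {P m P′} → Γ ⊩ P ∶ m →
            subst σ P ≡ just P′ → Δ ⊩ P′ ∶ m
  ⊩-subst ⊢σ ⊩𝟎 refl = ⊩𝟎
  -- If `σ a` were `⋆`, the result would be `nothing`, against `eq`; only `name b` remains.
  ⊩-subst {σ = σ} ⊢σ (⊩send {a} i d) eq with σ a | ⊢ᵥ-subst ⊢σ i
  ⊩-subst ⊢σ (⊩send i d) refl | name b | i′ = ⊩send i′ (⊢ᵥ-subst ⊢σ d)
  ⊩-subst {σ = σ} ⊢σ (⊩recv {a} {P} i d) eq
    with σ a | ⊢ᵥ-subst ⊢σ i | subst (exts σ) P in eqP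
  ⊩-subst ⊢σ (⊩recv i d) refl | name b | i′ | just P′ =
    ⊩recv i′ (⊩-subst (⊢ˢ-exts ⊢σ) d eqP)
  ⊩-subst {σ = σ} ⊢σ (⊩!recv {a} {P} i d lt) eq
    with σ a | ⊢ᵥ-subst ⊢σ i | subst (exts σ) P in eqP
  ⊩-subst ⊢σ (⊩!recv i d lt) refl | name b | i′ | just P′ =
    ⊩!recv i′ (⊩-subst (⊢ˢ-exts ⊢σ) d eqP) lt
  ⊩-subst {σ = σ} ⊢σ (⊩ν {P} d) eq with subst (exts σ) P in eqP
  ⊩-subst ⊢σ (⊩ν d) refl | just P′ = ⊩ν (⊩-subst (⊢ˢ-exts ⊢σ) d eqP)
  ⊩-subst {σ = σ} ⊢σ (⊩∣ {P} {Q} c d) eq with subst σ P in eqP | subst σ Q in eqQ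
  ⊩-subst ⊢σ (⊩∣ c d) refl | just P′ | just Q′ =
    ⊩∣ (⊩-subst ⊢σ c eqP) (⊩-subst ⊢σ d eqQ)

  ⊩-[] : ∀ {Γ v P P′ S T m} → Γ ⊢ᵥ v ∶ S → S ≤ₜ T → Γ ▸ T ⊩ P ∶ m →
         P [ v ] ≡ just P′ → Γ ⊩ P′ ∶ m
  ⊩-[] ⊢v S≤T d eq = ⊩-subst (⊢ˢ-single (⊢ᵥ-≤ₜ ⊢v S≤T)) d eq

  -- An equivalence because of `≡ₛ-sym`, and general in `Γ` because congruence passes under binders.
  ⊩-resp-≡ₛ : ∀ {P Q} → P ≡ₛ Q → ∀ {Γ m} → Γ ⊩ P ∶ m ⇔ Γ ⊩ Q ∶ m
  ⊩-resp-≡ₛ ≡ₛ-refl        = ⇔.refl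
  ⊩-resp-≡ₛ (≡ₛ-sym e)     = ⇔.sym (⊩-resp-≡ₛ e)
  ⊩-resp-≡ₛ (≡ₛ-trans e f) = ⇔.trans (⊩-resp-≡ₛ e) (⊩-resp-≡ₛ f)
  ⊩-resp-≡ₛ (∣-cong e f)   = mk⇔
    (λ { (⊩∣ c d) → ⊩∣ (to (⊩-resp-≡ₛ e) c) (to (⊩-resp-≡ₛ f) d) })
    (λ { (⊩∣ c d) → ⊩∣ (from (⊩-resp-≡ₛ e) c) (from (⊩-resp-≡ₛ f) d) })
  ⊩-resp-≡ₛ (ν-cong e)     = mk⇔
    (λ { (⊩ν d) → ⊩ν (to (⊩-resp-≡ₛ e) d) })
    (λ { (⊩ν d) → ⊩ν (from (⊩-resp-≡ₛ e) d) })
  ⊩-resp-≡ₛ (recv-cong e)  = mk⇔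
    (λ { (⊩recv a d) → ⊩recv a (to (⊩-resp-≡ₛ e) d) })
    (λ { (⊩recv a d) → ⊩recv a (from (⊩-resp-≡ₛ e) d) })
  ⊩-resp-≡ₛ (!recv-cong e) = mk⇔
    (λ { (⊩!recv a d lt) → ⊩!recv a (to (⊩-resp-≡ₛ e) d) lt })
    (λ { (⊩!recv a d lt) → ⊩!recv a (from (⊩-resp-≡ₛ e) d) lt })
  ⊩-resp-≡ₛ ∣-assoc        = mk⇔
    (λ { (⊩∣ {m = l} b (⊩∣ {m = m} {n} c d)) →
         ⊩-resp-≡ (+-assoc l m n) (⊩∣ (⊩∣ b c) d) })
    (λ { (⊩∣ {n = n} (⊩∣ {m = l} {m} b c) d) →
         ⊩-resp-≡ (sym (+-assoc l m n)) (⊩∣ b (⊩∣ c d)) })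
  ⊩-resp-≡ₛ ∣-comm         = mk⇔
    (λ { (⊩∣ {m = m} {n} c d) → ⊩-resp-≡ (+-comm n m) (⊩∣ d c) })
    (λ { (⊩∣ {m = m} {n} c d) → ⊩-resp-≡ (+-comm n m) (⊩∣ d c) })
  ⊩-resp-≡ₛ ∣-identityʳ    = mk⇔
    (λ { (⊩∣ d ⊩𝟎) → ⊩-resp-≡ (sym (+-identityʳ _)) d })
    (λ d → ⊩-resp-≡ (+-identityʳ _) (⊩∣ d ⊩𝟎))
  ⊩-resp-≡ₛ ν-𝟎            = mk⇔
    (λ { (⊩ν ⊩𝟎) → ⊩𝟎 })
    -- An arbitrary type for a name that `𝟎` never mentions.
    (λ { ⊩𝟎 → ⊩ν {T = 𝕌} ⊩𝟎 })
  ⊩-resp-≡ₛ (ν-comm {P})   = mk⇔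
    (λ { (⊩ν (⊩ν d)) → ⊩ν (⊩ν (⊩-rename⁺ ▸-swap d)) })
    (λ { (⊩ν (⊩ν d)) → ⊩ν (⊩ν (⊩-rename⁻ ▸-swap P d)) })
  ⊩-resp-≡ₛ (ν-extrude {P}) = mk⇔
    (λ { (⊩ν (⊩∣ c d)) → ⊩∣ (⊩-rename⁻ (λ _ → refl) P c) (⊩ν d) })
    (λ { (⊩∣ c (⊩ν d)) → ⊩ν (⊩∣ (⊩-rename⁺ (λ _ → refl) c) d) })

  ⟶-decreases : ∀ {Γ P P′ m} → P ⟶ P′ → Γ ⊩ P ∶ m → ∃ λ n → n < m × Γ ⊩ P′ ∶ n
  ⟶-decreases (comm eq) (⊩∣ (⊩recv {m = m} i d) (⊩send {k = l} o ⊢v)) =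
    -- The input already carries the cost of its continuation; the loss is the consumed output.
    m , m<m+n m (cost-pos l) , ⊩-[] ⊢v (proj₁ (channel-agreement i o)) d eq
  ⟶-decreases (!comm eq) (⊩∣ (⊩!recv {m = m} i d lt) (⊩send o ⊢v)) =
    let S≤T , k≤l = channel-agreement i o in
    -- The replicated input costs 0, so `m` replaces the cost of the output, whose level is at least
    -- `k`.
    m , <-≤-trans lt (cost-mono k≤l) , ⊩∣ (⊩!recv i d lt) (⊩-[] ⊢v S≤T d eq)
  ⟶-decreases (par r) (⊩∣ {n = n} c d) with ⟶-decreases r c
  ... | m′ , lt , c′ = m′ + n , +-monoˡ-< n lt , ⊩∣ c′ d
  ⟶-decreases (res r) (⊩ν d) with ⟶-decreases r d
  ... | m′ , lt , d′ = m′ , lt , ⊩ν d′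
  ⟶-decreases (struct e r f) d with ⟶-decreases r (to (⊩-resp-≡ₛ e) d)
  ... | m′ , lt , d′ = m′ , lt , to (⊩-resp-≡ₛ f) d′

  ⊩-terminates : ∀ {Γ P m} → Γ ⊩ P ∶ m → Terminates P
  ⊩-terminates {Γ} d (s , refl , steps) = go (<-wellFounded _) 0 d
    where
    go : ∀ {m} → Acc _<_ m → ∀ i → ¬ Γ ⊩ s i ∶ m
    go (acc rec) i d with ⟶-decreases (steps i) d
    ... | _ , lt , d′ = go (rec lt) (suc i) d′

-- Outputs under a replication count too, so that a bound on the whole process passes to replicated
-- bodies.
outputs : Process → ℕ
outputs 𝟎           = 0
outputs (P ∣ Q)     = outputs P + outputs Q
outputs (send a v)  = 1
outputs (ν P)       = outputs P
outputs (recv a P)  = outputs P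
outputs (!recv a P) = outputs P

module _ (N : ℕ) where
  open Costed (suc N ^_) (m^n>0 (suc N)) (^-monoʳ-≤ (suc N))

  -- The weight bounds the level of every output outside replications, so each of them costs at most
  -- `suc N ^ w`.
  ⊢⇒⊩ : ∀ {Γ P w} → outputs P ≤ N → Γ ⊢ P ∶ w →
        ∃ λ m → m ≤ outputs P * suc N ^ w × Γ ⊩ P ∶ m
  ⊢⇒⊩ le ⊢𝟎 = 0 , z≤n , ⊩𝟎
  ⊢⇒⊩ le (⊢send o d) = _ , ≤-reflexive (sym (*-identityˡ _)) , ⊩send o d
  ⊢⇒⊩ le (⊢recv i d) with ⊢⇒⊩ le d
  ... | m , bound , d′ = m , bound , ⊩recv i d′
  ⊢⇒⊩ le (⊢!recv {P = P} {k} {w = w} i d w<k) with ⊢⇒⊩ le d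
  ... | m , bound , d′ = 0 , z≤n , ⊩!recv i d′ (begin-strict
    m                      ≤⟨ bound ⟩
    -- Strict because the base `suc N` exceeds the number of outputs; the product is then
    -- `suc N ^ suc w`, and `w<k` says `suc w ≤ k`.
    outputs P * suc N ^ w  <⟨ *-monoˡ-< (suc N ^ w) {{m^n≢0 (suc N) w}} (s≤s le) ⟩
    suc N * suc N ^ w      ≤⟨ ^-monoʳ-≤ (suc N) w<k ⟩
    suc N ^ k              ∎)
    where open ≤-Reasoning
  ⊢⇒⊩ le (⊢ν d) with ⊢⇒⊩ le d
  ... | m , bound , d′ = m , bound , ⊩ν d′
  ⊢⇒⊩ le (⊢∣ {P} {Q} {v} {w} c d)
    with ⊢⇒⊩ (m+n≤o⇒m≤o (outputs P) le) c | ⊢⇒⊩ (m+n≤o⇒n≤o (outputs P) le) d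
  ... | m , bound , c′ | n , bound′ , d′ = m + n , bound″ , ⊩∣ c′ d′
    where
    open ≤-Reasoning
    b = suc N
    u = v ⊔ w
    bound″ = begin
      m + n                                  ≤⟨ +-mono-≤ bound bound′ ⟩
      outputs P * b ^ v + outputs Q * b ^ w  ≤⟨ +-mono-≤
        (*-monoʳ-≤ (outputs P) (^-monoʳ-≤ b (m≤m⊔n v w)))
        (*-monoʳ-≤ (outputs Q) (^-monoʳ-≤ b (m≤n⊔m v w))) ⟩
      outputs P * b ^ u + outputs Q * b ^ u  ≡⟨ *-distribʳ-+ (b ^ u) (outputs P) (outputs Q) ⟨
      (outputs P + outputs Q) * b ^ u        ∎

  ⊢⇒terminates : ∀ {Γ P w} → outputs P ≤ N → Γ ⊢ P ∶ w → Terminates P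
  ⊢⇒terminates le d with ⊢⇒⊩ le d
  ... | _ , _ , d′ = ⊩-terminates d′

theorem12 : (P : Process) (Γ : Env) (w : ℕ) → Γ ⊢ P ∶ w → Terminates P
theorem12 P Γ w = ⊢⇒terminates (outputs P) ≤-refl
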